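{- With $\delta(c)$ as defined in the context, as $c\to\infty$ we have $\delta(c)=\Omega(c^{1.05})$ and $\delta(c)=O(c^{1.59})$.
   Context: For integers $\ell,c\ge 1$ let $W(\ell,c)$ be the set of sequences $\alpha=(\alpha_1,\dots,\alpha_d)$ of length $d=\ell+c-2$ with entries in $\{1,2\}$ having exactly $\ell-1$ entries equal to $1$ and $c-1$ entries equal to $2$. For $0\le i\le d$ and $s\in\{1,2\}$ let $\nu_{i,s}:=1+|\{1\le j\le i:\alpha_j=s\}|$. Define integers recursively: $x_{1,0}:=x_{2,0}:=0$, and for $i=0,1,\dots,d$ in turn let $k_i:=1+\sum_{s\in\{1,2\}}\min_{j_1,j_2\ge 0,\ j_1+j_2=\nu_{i,s}-1}(x_{s,j_1}+x_{s,j_2})$, and, if $i<d$, set $x_{s,\nu_{i,s}}:=k_i$ for $s=\alpha_{i+1}$. This defines $x_{1,0},\dots,x_{1,\ell-1}$ and $x_{2,0},\dots,x_{2,c-1}$. Put $\beta(\alpha):=1+\min_{j_1,j_2\ge0,\ j_1+j_2=c-1}(x_{2,j_1}+x_{2,j_2})$ and $\delta(\alpha):=\min_{0\le j\le \ell-1}\frac{x_{1,j}+\beta(\alpha)}{j+1}$. Finally $\delta(1):=1$ and, for $c\ge 2$, $\delta(c):=\sup\{\delta(\alpha): \ell\ge 1,\ \alpha\in W(\ell,c),\ \alpha_{\ell+c-2}=2\}$. -}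

module Defs where

open import Data.Nat using (ℕ; zero; suc; _+_; _⊓_)
open import Data.Integer using (+_)
open import Data.Rational using (ℚ; _/_; 1ℚ) renaming (_⊓_ to _⊓ℚ_; _*_ to _*ℚ_)
open import Data.List using (List; []; _∷_; _++_; [_]; reverse; zipWith; length; filter)
open import Data.Product using (_×_; _,_; proj₁; proj₂)
open import Relation.Binary.PropositionalEquality using (_≡_)
open import Relation.Nullary using (Dec; yes; no)

data Sym : Set where
  one two : Sym

count : Sym → List Sym → ℕ
count s [] = 0
count one (one ∷ w) = suc (count one w)
count one (two ∷ w) = count one w
count two (one ∷ w) = count two w
count two (two ∷ w) = suc (count two w)

InW : ℕ → ℕ → List Sym → Set
InW ℓ c α = (count one α + 1 ≡ ℓ) × (count two α + 1 ≡ c)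

data LastIsTwo : List Sym → Set where
  last-two : (w : List Sym) → LastIsTwo (w ++ [ two ])

-- minimum of a list of naturals (only ever applied to nonempty lists)
minℕ : List ℕ → ℕ
minℕ [] = 0
minℕ (x ∷ []) = x
minℕ (x ∷ y ∷ xs) = x ⊓ minℕ (y ∷ xs)

-- For a list L = (x_0,…,x_{n-1}):  min_{j1+j2=n-1} (x_{j1} + x_{j2}).
minPairSum : List ℕ → ℕ
minPairSum L = minℕ (zipWith _+_ L (reverse L))

-- k_i computed from the current lists (x_{1,0..ν_{i,1}-1}) and (x_{2,0..ν_{i,2}-1}).
kVal : List ℕ → List ℕ → ℕ
kVal xs1 xs2 = 1 + (minPairSum xs1 + minPairSum xs2)

run : List Sym → List ℕ → List ℕ → List ℕ × List ℕ
run [] xs1 xs2 = xs1 , xs2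
run (one ∷ w) xs1 xs2 = run w (xs1 ++ [ kVal xs1 xs2 ]) xs2
run (two ∷ w) xs1 xs2 = run w xs1 (xs2 ++ [ kVal xs1 xs2 ])

xs₁ xs₂ : List Sym → List ℕ
xs₁ α = proj₁ (run α (0 ∷ []) (0 ∷ []))
xs₂ α = proj₂ (run α (0 ∷ []) (0 ∷ []))

βα : List Sym → ℕ
βα α = 1 + minPairSum (xs₂ α)

minℚ : ℚ → List ℚ → ℚ
minℚ q [] = q
minℚ q (r ∷ rs) = q ⊓ℚ minℚ r rs

ratios : ℕ → ℕ → List ℕ → List ℚ
ratios b j [] = []
ratios b j (x ∷ xs) = ((+ (x + b)) / suc j) ∷ ratios b (suc j) xs

δα : List Sym → ℚ
δα α with ratios (βα α) 0 (xs₁ α)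
... | [] = 1ℚ   -- never happens: xs₁ α is nonempty
... | q ∷ qs = minℚ q qs

_^ℚ_ : ℚ → ℕ → ℚ
q ^ℚ zero = 1ℚ
q ^ℚ suc n = q *ℚ (q ^ℚ n)

-- Upper bound: if every value k computed while fewer than N entries of the second list exist is at
-- most D times the length of the first list, then 3 D works for 2 N. Indeed, let a be the length of
-- the first list when the N-th entry of the second was added. Splitting the index sum of the second
-- list at N costs at most 2 D a, and splitting off the index a - 1 in a first list of length ℓ costs
-- D a plus the entry of index ℓ - a, which is at most 3 D (ℓ - a) by induction. So δ(c) = O(c^{log₂ 3}),
-- and 3^100 ≤ 2^159.
--
-- Lower bound: to an α with length parameter c and slope D = δ(α), append 1s until there are A of them,
-- then c 2s, then 1s until there are B, then 2c 2s. To leading order in A and B the second list consists of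
-- blocks of values 0, AD, (A+B)D, (2A+B)D, and the new slope is the minimum of the ratios at indices A and B
-- of the first list, whose entries there are AD and (A+B)D: it is min (3 + B/A, 2 + 3A/B) · D.
-- The optimum is at B/A = (√13 - 1)/2, and its convergent 43/33 gives more than 4.3, which leaves room for
-- the lower-order terms. So δ(4c) ≥ 4.3 δ(c), and 4^21 · 10^20 ≤ 43^20.
module Submission where

open import Defs
open import Data.Empty using (⊥-elim)
open import Data.Integer as ℤ using (+_; +≤+)
import Data.Integer.Properties as ℤ
open import Data.List using (List; []; _∷_; _++_; [_]; reverse; zipWith; length)
open import Data.List.Properties using (unfold-reverse; length-reverse; length-zipWith; length-++)
open import Data.List.Relation.Unary.All using (All; []; _∷_)
open import Data.List.Relation.Unary.Any using (Any; here; there)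
open import Data.Nat using (ℕ; zero; suc; _+_; _*_; _∸_; _^_; _⊓_; _≤_; _<_; _≥_; z≤n; s≤s; z<s; s<s; _≤?_; _<?_; NonZero)
open import Data.Nat.Properties
open import Data.Nat.Tactic.RingSolver using (solve-∀)
open import Data.Product using (Σ; _×_; _,_; proj₁; proj₂; ∃-syntax; ∃₂)
open import Data.Rational as ℚ using (ℚ; _/_; 0ℚ; toℚᵘ)
import Data.Rational.Properties as ℚ
open import Data.Rational.Unnormalised as ℚᵘ using (mkℚᵘ; *≤*)
import Data.Rational.Unnormalised.Properties as ℚᵘ
open import Data.Sum using (_⊎_; inj₁; inj₂)
open import Data.Unit using (tt)
open import Relation.Binary.PropositionalEquality using (_≡_; refl; sym; trans; cong; cong₂; subst; subst₂)
open import Relation.Nullary using (yes; no)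

-- Indexed entries and minimal pair sums

infixl 9 _‼_

-- Junk value 0 past the end of the list.
_‼_ : List ℕ → ℕ → ℕ
[] ‼ i = 0
(x ∷ xs) ‼ zero = x
(x ∷ xs) ‼ suc i = xs ‼ i

-- A record rather than a bare function type, so that unification can recover `Q` and `L`.
record Entries (Q : ℕ → ℕ → Set) (L : List ℕ) : Set where
  constructor entries
  field at : ∀ i → i < length L → Q i (L ‼ i)

open Entries

length-∷ʳ : ∀ (L : List ℕ) {k} → length (L ++ [ k ]) ≡ suc (length L)
length-∷ʳ L = trans (length-++ L) (+-comm (length L) 1)

entries-∷ʳ : ∀ {Q : ℕ → ℕ → Set} (L : List ℕ) {k} →
  Entries Q L → Q (length L) k → Entries Q (L ++ [ k ])
entries-∷ʳ {Q} L {k} h q = entries (go Q L (at h) q)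
  where
  -- Dropping the head shifts the index, so `Q` has to vary in the recursion.
  go : ∀ (Q : ℕ → ℕ → Set) L → (∀ i → i < length L → Q i (L ‼ i)) → Q (length L) k →
    ∀ i → i < length (L ++ [ k ]) → Q i ((L ++ [ k ]) ‼ i)
  go Q [] h q zero _ = q
  go Q [] h q (suc i) (s≤s ())
  go Q (x ∷ L) h q zero _ = h 0 z<s
  go Q (x ∷ L) h q (suc i) (s≤s i<) =
    go (λ i → Q (suc i)) L (λ i i< → h (suc i) (s<s i<)) q i i<

entries-map : ∀ {Q R : ℕ → ℕ → Set} {L : List ℕ} →
  (∀ {i x} → i < length L → Q i x → R i x) → Entries Q L → Entries R L
entries-map f h = entries λ i i< → f i< (at h i i<)

entries-[0] : ∀ {Q : ℕ → ℕ → Set} → Q 0 0 → Entries Q [ 0 ]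
entries-[0] {Q} q = entries go
  where
  go : ∀ i → i < 1 → Q i ([ 0 ] ‼ i)
  go zero _ = q
  go (suc i) (s≤s ())

minℕ-attained : ∀ L → 0 < length L → ∃[ i ] (i < length L × minℕ L ≡ L ‼ i)
minℕ-attained (x ∷ []) _ = 0 , z<s , refl
minℕ-attained (x ∷ y ∷ L) _ with ⊓-sel x (minℕ (y ∷ L)) | minℕ-attained (y ∷ L) z<s
... | inj₁ e | _ = 0 , z<s , e
... | inj₂ e | i , i< , e′ = suc i , s<s i< , trans e e′

minℕ-≤ : ∀ L i → i < length L → minℕ L ≤ L ‼ i
minℕ-≤ (x ∷ []) zero _ = ≤-refl
minℕ-≤ (x ∷ []) (suc i) (s≤s ())
minℕ-≤ (x ∷ y ∷ L) zero _ = m⊓n≤m x _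
minℕ-≤ (x ∷ y ∷ L) (suc i) (s≤s i<) = ≤-trans (m⊓n≤n x _) (minℕ-≤ (y ∷ L) i i<)

‼-∷ʳ-< : ∀ L {k i} → i < length L → (L ++ [ k ]) ‼ i ≡ L ‼ i
‼-∷ʳ-< (x ∷ L) {i = zero} _ = refl
‼-∷ʳ-< (x ∷ L) {i = suc i} (s≤s i<) = ‼-∷ʳ-< L i<

‼-∷ʳ-≡ : ∀ L {k i} → i ≡ length L → (L ++ [ k ]) ‼ i ≡ k
‼-∷ʳ-≡ [] refl = refl
‼-∷ʳ-≡ (x ∷ L) refl = ‼-∷ʳ-≡ L refl

‼-reverse : ∀ L {i j} → suc (i + j) ≡ length L → reverse L ‼ i ≡ L ‼ j
‼-reverse (x ∷ L) {i} {zero} e rewrite unfold-reverse x L | +-identityʳ i =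
  ‼-∷ʳ-≡ (reverse L) (trans (suc-injective e) (sym (length-reverse L)))
‼-reverse (x ∷ L) {i} {suc j} e rewrite unfold-reverse x L | +-suc i j =
  trans (‼-∷ʳ-< (reverse L) (subst (i <_) (trans (suc-injective e) (sym (length-reverse L))) (s≤s (m≤m+n i j))))
    (‼-reverse L (suc-injective e))

‼-zipWith : ∀ L M {i} → i < length L → i < length M → zipWith _+_ L M ‼ i ≡ L ‼ i + M ‼ i
‼-zipWith (x ∷ L) (y ∷ M) {zero} _ _ = refl
‼-zipWith (x ∷ L) (y ∷ M) {suc i} (s≤s a) (s≤s b) = ‼-zipWith L M a b

length-pairSums : ∀ L → length (zipWith _+_ L (reverse L)) ≡ length L
length-pairSums L = trans (length-zipWith _+_ L (reverse L))
  (trans (cong (length L ⊓_) (length-reverse L)) (⊓-idem (length L)))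

pairSum : ∀ L {i j} → suc (i + j) ≡ length L → zipWith _+_ L (reverse L) ‼ i ≡ L ‼ i + L ‼ j
pairSum L {i} {j} e = trans
  (‼-zipWith L (reverse L) i< (subst (i <_) (sym (length-reverse L)) i<))
  (cong (_+_ (L ‼ i)) (‼-reverse L e))
  where
  i< : i < length L
  i< = subst (i <_) e (s≤s (m≤m+n i j))

-- Upper bounds on `kVal` exhibit one pair through this lemma; lower bounds inspect the optimal pair
-- given by `minPairSum-attained`.
minPairSum-≤ : ∀ L i j → suc (i + j) ≡ length L → minPairSum L ≤ L ‼ i + L ‼ j
minPairSum-≤ L i j e = subst (minPairSum L ≤_) (pairSum L e)
  (minℕ-≤ (zipWith _+_ L (reverse L)) i
    (subst (i <_) (trans e (sym (length-pairSums L))) (s≤s (m≤m+n i j))))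

minPairSum-attained : ∀ L → 0 < length L →
  ∃₂ λ i j → suc (i + j) ≡ length L × minPairSum L ≡ L ‼ i + L ‼ j
minPairSum-attained L 0<
  with minℕ-attained (zipWith _+_ L (reverse L)) (subst (0 <_) (sym (length-pairSums L)) 0<)
... | i , i< , e =
  i , length L ∸ suc i , i+j , trans e (pairSum L i+j)
  where
  i+j : suc (i + (length L ∸ suc i)) ≡ length L
  i+j = m+[n∸m]≡n (subst (i <_) (length-pairSums L) i<)

-- Reachable states of the recursion

data Reach : List ℕ → List ℕ → Set where
  start : Reach [ 0 ] [ 0 ]
  addOne : ∀ {X Y} → Reach X Y → Reach (X ++ [ kVal X Y ]) Y
  addTwo : ∀ {X Y} → Reach X Y → Reach X (Y ++ [ kVal X Y ])

-- `run` consumes the first symbol while `Reach` grows by the last one, hence the arbitrary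
-- reachable starting state.
run-Reach : ∀ w {X Y} → Reach X Y → Reach (proj₁ (run w X Y)) (proj₂ (run w X Y))
run-Reach [] r = r
run-Reach (one ∷ w) r = run-Reach w (addOne r)
run-Reach (two ∷ w) r = run-Reach w (addTwo r)

run-length : ∀ w X Y → length (proj₂ (run w X Y)) ≡ count two w + length Y
run-length [] X Y = refl
run-length (one ∷ w) X Y = run-length w _ Y
run-length (two ∷ w) X Y = trans (run-length w X _)
  (trans (cong (_+_ (count two w)) (length-∷ʳ Y)) (+-suc (count two w) (length Y)))

run-++ : ∀ u v X Y → run (u ++ v) X Y ≡ run v (proj₁ (run u X Y)) (proj₂ (run u X Y))
run-++ [] v X Y = refl
run-++ (one ∷ u) v X Y = run-++ u v _ Y
run-++ (two ∷ u) v X Y = run-++ u v X _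

-- Recovers a word α from lists built step by step, as the lower bound needs.
Reach-run : ∀ {X Y} → Reach X Y → ∃[ w ] (run w [ 0 ] [ 0 ] ≡ (X , Y))
Reach-run start = [] , refl
Reach-run (addOne r) with Reach-run r
... | w , e = w ++ [ one ] , trans (run-++ w [ one ] _ _) (cong (λ s → run [ one ] (proj₁ s) (proj₂ s)) e)
Reach-run (addTwo r) with Reach-run r
... | w , e = w ++ [ two ] , trans (run-++ w [ two ] _ _) (cong (λ s → run [ two ] (proj₁ s) (proj₂ s)) e)

Reach-X>0 : ∀ {X Y} → Reach X Y → 0 < length X
Reach-X>0 start = z<s
Reach-X>0 (addOne {X} r) = subst (0 <_) (sym (length-∷ʳ X)) z<s
Reach-X>0 (addTwo r) = Reach-X>0 r

Reach-Y>0 : ∀ {X Y} → Reach X Y → 0 < length Y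
Reach-Y>0 start = z<s
Reach-Y>0 (addOne r) = Reach-Y>0 r
Reach-Y>0 (addTwo {X} {Y} r) = subst (0 <_) (sym (length-∷ʳ Y)) z<s

-- The upper bound on δ(c)

-- The condition on `Y` concerns the state before a step, so the value that becomes the N-th entry
-- of `Y` is still covered.
Bounded : ℕ → ℕ → Set
Bounded N D = ∀ {X Y} → Reach X Y → length Y < N → kVal X Y ≤ D * length X

module _ {N D : ℕ} (B : Bounded N D) where

  -- The entry of `X` at index i was computed when `X` had length i, and every entry of `Y` when `X`
  -- was at most as long as now.
  entries-bounded : ∀ {X Y} → Reach X Y → length Y < N →
    Entries (λ i x → x ≤ D * i) X × Entries (λ _ y → y ≤ D * length X) Y
  entries-bounded start _ = entries-[0] z≤n , entries-[0] z≤n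
  entries-bounded (addOne {X} {Y} r) Y< with entries-bounded r Y<
  ... | hX , hY = entries-∷ʳ X hX (B r Y<) ,
    entries-map (λ _ h → ≤-trans h (*-monoʳ-≤ D (subst (length X ≤_) (sym (length-∷ʳ X)) (n≤1+n _)))) hY
  entries-bounded (addTwo {X} {Y} r) Y<
    with <-trans (n<1+n (length Y)) (subst (_< N) (length-∷ʳ Y) Y<)
  ... | Y<′ with entries-bounded r Y<′
  ... | hX , hY = hX , entries-∷ʳ Y hY (B r Y<′)

  -- a is the number of entries of X present when the N-th entry of Y was added.
  Split : List ℕ → List ℕ → Set
  Split X Y = ∃[ a ] (suc a ≤ length X × N ≤ length Y ×
    Entries (λ i x → i < suc a → x ≤ D * i) X × Entries (λ i y → i < N → y ≤ D * suc a) Y)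

  -- Induction invariant: while `Y` is short `Bounded` applies directly, afterwards the recorded
  -- split replaces it.
  Tracked : List ℕ → List ℕ → Set
  Tracked X Y = Entries (λ i x → x ≤ 3 * D * i) X × (length Y < N ⊎ Split X Y)

  -- After the split, index `a` of `X` costs D a, its complement r costs 3 D r by the invariant, and
  -- two indices of `Y` below N cost D (a + 1) each. The 1 in `kVal` is paid by one further D, and
  -- the total is exactly 3 D (a + 1 + r).
  kVal-bounded : 1 ≤ D → ∀ {X Y} → Reach X Y → length Y < N + N → Tracked X Y →
    kVal X Y ≤ 3 * D * length X
  kVal-bounded _ {X} r _ (_ , inj₁ Y<) = ≤-trans (B r Y<) (*-monoˡ-≤ (length X) (m≤m+n D _))
  kVal-bounded 1≤D {X} {Y} _ Y< (hX , inj₂ (a , a< , N≤Y , hXa , hYa)) = begin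
    suc (minPairSum X + minPairSum Y)
      ≤⟨ s≤s (+-mono-≤ (minPairSum-≤ X a r pX)
                       (pairY N refl)) ⟩
    suc ((X ‼ a + X ‼ r) + (D * suc a + D * suc a))
      ≤⟨ +-mono-≤ 1≤D (+-monoˡ-≤ _ (+-mono-≤ (at hXa a a< ≤-refl) (at hX r r<))) ⟩
    D + ((D * a + 3 * D * r) + (D * suc a + D * suc a))
      ≡⟨ arith D a r ⟩
    3 * D * (suc a + r)
      ≡⟨ cong (3 * D *_) (m+[n∸m]≡n a<) ⟩
    3 * D * length X ∎
    where
    open ≤-Reasoning
    r : ℕ
    r = length X ∸ suc a
    pX : suc (a + r) ≡ length X
    pX = m+[n∸m]≡n a<
    r< : r < length X
    r< = subst (r <_) pX (s≤s (m≤n+m r a))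
    arith : ∀ D a r → D + ((D * a + 3 * D * r) + (D * suc a + D * suc a)) ≡ 3 * D * (suc a + r)
    arith = solve-∀
    -- As `Y` is shorter than 2 N, the complement of index N - 1 is below N as well. The copy `M`
    -- allows matching on the module parameter `N`.
    pairY : ∀ M → M ≡ N → minPairSum Y ≤ D * suc a + D * suc a
    pairY zero refl = ⊥-elim (n≮0 Y<)
    pairY (suc M) refl = ≤-trans (minPairSum-≤ Y M j pY)
      (+-mono-≤ (at hYa M N≤Y ≤-refl) (at hYa j (subst (j <_) pY (s≤s (m≤n+m j M))) j<))
      where
      j : ℕ
      j = length Y ∸ suc M
      pY : suc (M + j) ≡ length Y
      pY = m+[n∸m]≡n N≤Y
      j< : j < suc M
      j< = +-cancelˡ-< (suc M) j (suc M) (subst (_< suc M + suc M) (sym pY) Y<)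

  tracked : 1 ≤ D → ∀ {X Y} → Reach X Y → length Y < N + N → Tracked X Y
  tracked _ start _ = entries-[0] z≤n , second
    where
    second : 1 < N ⊎ Split [ 0 ] [ 0 ]
    -- `Y` starts with one entry, so for N ≤ 1 the split is already present.
    second with N ≤? 1
    ... | no N≰1 = inj₁ (≰⇒> N≰1)
    ... | yes N≤1 = inj₂ (0 , ≤-refl , N≤1 , entries-[0] (λ _ → z≤n) , entries-[0] (λ _ → z≤n))
  tracked 1≤D (addOne {X} {Y} r) Y< with tracked 1≤D r Y<
  ... | t@(hX , s) = entries-∷ʳ X hX (kVal-bounded 1≤D r Y< t) , second s
    where
    X⁺ = X ++ [ kVal X Y ]
    second : length Y < N ⊎ Split X Y → length Y < N ⊎ Split X⁺ Y
    second (inj₁ h) = inj₁ h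
    second (inj₂ (a , a< , N≤Y , hXa , hYa)) = inj₂
      (a , ≤-trans a< (subst (length X ≤_) (sym (length-∷ʳ X)) (n≤1+n _)) , N≤Y ,
       entries-∷ʳ X hXa (λ X<a → ⊥-elim (<⇒≱ X<a a<)) , hYa)
  tracked 1≤D (addTwo {X} {Y} r) Y<
    with <-trans (n<1+n (length Y)) (subst (_< N + N) (length-∷ʳ Y) Y<)
  ... | Y<′ with tracked 1≤D r Y<′
  ... | hX , s = hX , second s
    where
    Y⁺ = Y ++ [ kVal X Y ]
    second : length Y < N ⊎ Split X Y → length Y⁺ < N ⊎ Split X Y⁺
    second (inj₂ (a , a< , N≤Y , hXa , hYa)) = inj₂
      (a , a< , ≤-trans N≤Y (subst (length Y ≤_) (sym (length-∷ʳ Y)) (n≤1+n _)) , hXa ,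
       entries-∷ʳ Y hYa (λ Y<N → ⊥-elim (<⇒≱ Y<N N≤Y)))
    second (inj₁ Y<N) with N ≤? length Y⁺
    ... | no N≰ = inj₁ (≰⇒> N≰)
    -- This step brings `Y` to length N. Its value still obeys `B`, since `Y` was shorter before;
    -- `X` has length `suc a`, making `a` its last index.
    ... | yes N≤ = inj₂ (split (length X) refl (Reach-X>0 r))
      where
      split : ∀ ℓ → ℓ ≡ length X → 0 < ℓ → Split X Y⁺
      split (suc a) e _ with entries-bounded r Y<N
      ... | hX′ , hY′ = a , ≤-reflexive e , N≤ , entries-map (λ _ h _ → h) hX′ ,
        subst (λ ℓ → Entries (λ i y → i < N → y ≤ D * ℓ) Y⁺) (sym e)
          (entries-map (λ _ h _ → h) (entries-∷ʳ Y hY′ (B r Y<N)))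

  Bounded-double : 1 ≤ D → Bounded (N + N) (3 * D)
  Bounded-double 1≤D r Y< = kVal-bounded 1≤D r Y< (tracked 1≤D r Y<)

-- For m = 0 the bound is vacuous because `Y` is never empty; each doubling of N triples D.
Bounded-^ : ∀ m → Bounded (2 ^ m) (3 ^ m)
Bounded-^ zero r Y< = ⊥-elim (<⇒≱ Y< (Reach-Y>0 r))
Bounded-^ (suc m) = subst (λ N → Bounded N (3 ^ suc m)) (cong (_+_ (2 ^ m)) (sym (+-identityʳ _)))
  (Bounded-double (Bounded-^ m) (m^n>0 3 m))

-- The last index j of `X` suffices: the entry there is at most D j, and β is at most `kVal`, hence
-- at most D (j + 1).
last-ratio-bounded : ∀ {N D X Y} → Bounded N D → Reach X Y → length Y < N →
  ∃[ j ] (j < length X × X ‼ j + suc (minPairSum Y) ≤ 2 * D * suc j)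
last-ratio-bounded {N} {D} {X} {Y} B r Y< = go (length X) refl (Reach-X>0 r)
  where
  go : ∀ ℓ → ℓ ≡ length X → 0 < ℓ → ∃[ j ] (j < length X × X ‼ j + suc (minPairSum Y) ≤ 2 * D * suc j)
  go (suc j) e _ = j , ≤-reflexive e , (begin
    X ‼ j + suc (minPairSum Y)
      ≤⟨ +-mono-≤ (at (proj₁ (entries-bounded {N} {D} B r Y<)) j (≤-reflexive e))
           (≤-trans (s≤s (m≤n+m _ (minPairSum X))) (B r Y<)) ⟩
    D * j + D * length X ≡⟨ cong (λ ℓ → D * j + D * ℓ) (sym e) ⟩
    D * j + D * suc j ≤⟨ +-monoˡ-≤ _ (*-monoʳ-≤ D (n≤1+n j)) ⟩
    D * suc j + D * suc j ≡⟨ arith D (suc j) ⟩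
    2 * D * suc j ∎)
    where
    open ≤-Reasoning
    arith : ∀ D s → D * s + D * s ≡ 2 * D * s
    arith = solve-∀

-- The lower bound on δ(c)

ones : ℕ → List ℕ → List ℕ → List ℕ
ones zero X Y = X
ones (suc n) X Y = ones n X Y ++ [ kVal (ones n X Y) Y ]

twos : ℕ → List ℕ → List ℕ → List ℕ
twos zero X Y = Y
twos (suc n) X Y = twos n X Y ++ [ kVal X (twos n X Y) ]

ones-Reach : ∀ n {X Y} → Reach X Y → Reach (ones n X Y) Y
ones-Reach zero r = r
ones-Reach (suc n) r = addOne (ones-Reach n r)

twos-Reach : ∀ n {X Y} → Reach X Y → Reach X (twos n X Y)
twos-Reach zero r = r
twos-Reach (suc n) r = addTwo (twos-Reach n r)

ones-length : ∀ n X Y → length (ones n X Y) ≡ n + length X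
ones-length zero X Y = refl
ones-length (suc n) X Y = trans (length-∷ʳ (ones n X Y)) (cong suc (ones-length n X Y))

twos-length : ∀ n X Y → length (twos n X Y) ≡ n + length Y
twos-length zero X Y = refl
twos-length (suc n) X Y = trans (length-∷ʳ (twos n X Y)) (cong suc (twos-length n X Y))

-- If i < a and j < b, then i + j + 2 ≤ a + b ≤ n, contradicting n = i + j + 1.
split-index : ∀ {n i j} a b → suc (i + j) ≡ n → a + b ≤ n → a ≤ i ⊎ b ≤ j
split-index {n} {i} {j} a b e h with a ≤? i | b ≤? j
... | yes a≤i | _ = inj₁ a≤i
... | no _ | yes b≤j = inj₂ b≤j
... | no a≰i | no b≰j = ⊥-elim (<⇒≱ (+-mono-<-≤ {i} {a} {suc j} {b} (≰⇒> a≰i) (≰⇒> b≰j))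
  (subst (a + b ≤_) (trans (sym e) (sym (+-suc i j))) h))

module Scaled (p q : ℕ) where

  -- For E = q β this says that all ratios are at least p / q. `E` keeps its initial value while the
  -- lists grow.
  Superlinear : ℕ → List ℕ → Set
  Superlinear E = Entries (λ i x → suc i * p ≤ q * x + E)

  -- The bounds at the two indices add up, since (i + 1) + (j + 1) = `length X` + 1; the error
  -- doubles.
  superlinear-pairs : ∀ {E X} → 0 < length X → Superlinear E X →
    suc (length X) * p ≤ q * minPairSum X + (E + E)
  superlinear-pairs {E} {X} X>0 h with minPairSum-attained X X>0
  ... | i , j , e , eq = begin
    suc (length X) * p ≡⟨ cong (λ n → suc n * p) (sym e) ⟩
    suc (suc (i + j)) * p ≡⟨ arith₁ i j p ⟩
    suc i * p + suc j * p
      ≤⟨ +-mono-≤ (at h i (subst (i <_) e (s≤s (m≤m+n i j)))) (at h j (subst (j <_) e (s≤s (m≤n+m j i)))) ⟩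
    q * X ‼ i + E + (q * X ‼ j + E) ≡⟨ arith₂ q (X ‼ i) (X ‼ j) E ⟩
    q * (X ‼ i + X ‼ j) + (E + E) ≡⟨ cong (λ s → q * s + (E + E)) (sym eq) ⟩
    q * minPairSum X + (E + E) ∎
    where
    open ≤-Reasoning
    arith₁ : ∀ i j p → suc (suc (i + j)) * p ≡ suc i * p + suc j * p
    arith₁ = solve-∀
    arith₂ : ∀ q x y E → q * x + E + (q * y + E) ≡ q * (x + y) + (E + E)
    arith₂ = solve-∀

  kVal-superlinear : ∀ {E S} X Y → 0 < length X → Superlinear E X → S ≤ q * suc (minPairSum Y) →
    S + suc (length X) * p ≤ q * kVal X Y + (E + E)
  kVal-superlinear {E} {S} X Y X>0 h S≤ = begin
    S + suc (length X) * p ≤⟨ +-mono-≤ S≤ (superlinear-pairs X>0 h) ⟩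
    q * suc (minPairSum Y) + (q * minPairSum X + (E + E)) ≡⟨ arith q (minPairSum X) (minPairSum Y) E ⟩
    q * kVal X Y + (E + E) ∎
    where
    open ≤-Reasoning
    arith : ∀ q x y E → q * suc y + (q * x + (E + E)) ≡ q * suc (x + y) + (E + E)
    arith = solve-∀

  -- A pair sum loses 2 E, but the second list contributes at least E, so the error stays E.
  ones-superlinear : ∀ {E X Y} → E ≤ q * suc (minPairSum Y) → 0 < length X → Superlinear E X →
    ∀ n → Superlinear E (ones n X Y)
  ones-superlinear E≤ X>0 h zero = h
  ones-superlinear {E} {X} {Y} E≤ X>0 h (suc n) =
    entries-∷ʳ X′ ih (+-cancelʳ-≤ E _ _ (begin
      suc (length X′) * p + E ≡⟨ +-comm _ E ⟩
      E + suc (length X′) * p ≤⟨ kVal-superlinear X′ Y X′>0 ih E≤ ⟩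
      q * kVal X′ Y + (E + E) ≡⟨ sym (+-assoc _ E E) ⟩
      q * kVal X′ Y + E + E ∎))
    where
    open ≤-Reasoning
    X′ = ones n X Y
    ih = ones-superlinear E≤ X>0 h n
    X′>0 : 0 < length X′
    X′>0 = subst (0 <_) (sym (ones-length n X Y)) (≤-trans X>0 (m≤n+m _ n))

  -- Entries at index A or later are newly appended and gain the contribution S of the second list.
  -- Their pair sums are estimated by `Superlinear` alone, so neither gains nor errors compound.
  ones-gain : ∀ {E S A X Y} → E ≤ S → S ≤ q * suc (minPairSum Y) → 0 < length X → length X ≤ A →
    Superlinear E X → ∀ n → Entries (λ i x → A ≤ i → S + suc i * p ≤ q * x + (E + E)) (ones n X Y)
  ones-gain _ _ _ X≤A _ zero = entries λ i i<X A≤i → ⊥-elim (<⇒≱ i<X (≤-trans X≤A A≤i))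
  ones-gain {X = X} {Y} E≤S S≤ X>0 X≤A h (suc n) =
    entries-∷ʳ X′ (ones-gain E≤S S≤ X>0 X≤A h n)
      (λ _ → kVal-superlinear X′ Y X′>0 (ones-superlinear (≤-trans E≤S S≤) X>0 h n) S≤)
    where
    X′ = ones n X Y
    X′>0 : 0 < length X′
    X′>0 = subst (0 <_) (sym (ones-length n X Y)) (≤-trans X>0 (m≤n+m _ n))

  From : ℕ → ℕ → List ℕ → Set
  From a T = Entries (λ j y → a ≤ j → T ≤ q * y)

  from-end : ∀ {a T Y} → length Y ≤ a → From a T Y
  from-end Y≤a = entries λ j j<Y a≤j → ⊥-elim (<⇒≱ j<Y (≤-trans Y≤a a≤j))

  kVal-≥ : ∀ {S T} X Y → S ≤ q * minPairSum Y → T ≤ q * minPairSum X → S + T ≤ q * kVal X Y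
  kVal-≥ X Y hY hX = ≤-trans (+-mono-≤ hY hX) (begin
    q * minPairSum Y + q * minPairSum X ≡⟨ sym (*-distribˡ-+ q (minPairSum Y) _) ⟩
    q * (minPairSum Y + minPairSum X) ≡⟨ cong (q *_) (+-comm (minPairSum Y) _) ⟩
    q * (minPairSum X + minPairSum Y) ≤⟨ *-monoʳ-≤ q (n≤1+n _) ⟩
    q * kVal X Y ∎)
    where open ≤-Reasoning

  pairs-≥ : ∀ {T} Y → 0 < length Y →
    (∀ i j → i < length Y → j < length Y → suc (i + j) ≡ length Y → T ≤ q * Y ‼ i + q * Y ‼ j) →
    T ≤ q * minPairSum Y
  pairs-≥ {T} Y Y>0 h with minPairSum-attained Y Y>0
  ... | i , j , e , eq = subst (T ≤_) (trans (sym (*-distribˡ-+ q (Y ‼ i) _)) (cong (q *_) (sym eq)))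
    (h i j (subst (i <_) e (s≤s (m≤m+n i j))) (subst (j <_) e (s≤s (m≤n+m j i))) e)

  module Blocks (c U W : ℕ) (U≤W : U ≤ W) where

    F₁ F₂ F₃ : List ℕ → Set
    F₁ = From c U
    F₂ = From (c + c) (U + W)
    F₃ = From (c + c + c) (U + (U + W))

    pairs₁ : ∀ {Y} → 0 < length Y → c + c ≤ length Y → F₁ Y → U ≤ q * minPairSum Y
    pairs₁ {Y} Y>0 Y≥ f₁ = pairs-≥ Y Y>0 go
      where
      go : ∀ i j → i < length Y → j < length Y → suc (i + j) ≡ length Y → U ≤ q * Y ‼ i + q * Y ‼ j
      go i j i< j< e with split-index c c e Y≥
      ... | inj₁ c≤i = m≤n⇒m≤n+o _ (at f₁ i i< c≤i)
      ... | inj₂ c≤j = m≤n⇒m≤o+n _ (at f₁ j j< c≤j)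

    -- Either one index reaches 2 c, which is worth U + W ≥ 2 U, or both reach c, worth U each.
    pairs₂ : ∀ {Y} → 0 < length Y → c + c + c ≤ length Y → F₁ Y → F₂ Y → U + U ≤ q * minPairSum Y
    pairs₂ {Y} Y>0 Y≥ f₁ f₂ = pairs-≥ Y Y>0 go
      where
      2U≤ : U + U ≤ U + W
      2U≤ = +-monoʳ-≤ U U≤W
      go : ∀ i j → i < length Y → j < length Y → suc (i + j) ≡ length Y → U + U ≤ q * Y ‼ i + q * Y ‼ j
      go i j i< j< e
        with split-index c (c + c) e (subst (_≤ length Y) (+-assoc c c c) Y≥) | split-index (c + c) c e Y≥
      ... | _ | inj₁ 2c≤i = m≤n⇒m≤n+o _ (≤-trans 2U≤ (at f₂ i i< 2c≤i))
      ... | inj₂ 2c≤j | _ = m≤n⇒m≤o+n _ (≤-trans 2U≤ (at f₂ j j< 2c≤j))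
      ... | inj₁ c≤i | inj₂ c≤j = +-mono-≤ (at f₁ i i< c≤i) (at f₁ j j< c≤j)

    -- Either one index reaches 3 c, or both reach c and one of them reaches 2 c.
    pairs₃ : ∀ {Y} → 0 < length Y → c + c + c + c ≤ length Y → F₁ Y → F₂ Y → F₃ Y →
      U + (U + W) ≤ q * minPairSum Y
    pairs₃ {Y} Y>0 Y≥ f₁ f₂ f₃ = pairs-≥ Y Y>0 go
      where
      go : ∀ i j → i < length Y → j < length Y → suc (i + j) ≡ length Y →
        U + (U + W) ≤ q * Y ‼ i + q * Y ‼ j
      go i j i< j< e
        with split-index c (c + c + c) e (subst (_≤ length Y) (arith₁ c) Y≥)
           | split-index (c + c + c) c e Y≥
           | split-index (c + c) (c + c) e (subst (_≤ length Y) (arith₂ c) Y≥)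
        where
        arith₁ : ∀ c → c + c + c + c ≡ c + (c + c + c)
        arith₁ = solve-∀
        arith₂ : ∀ c → c + c + c + c ≡ c + c + (c + c)
        arith₂ = solve-∀
      ... | inj₂ 3c≤j | _ | _ = m≤n⇒m≤o+n _ (at f₃ j j< 3c≤j)
      ... | _ | inj₁ 3c≤i | _ = m≤n⇒m≤n+o _ (at f₃ i i< 3c≤i)
      ... | inj₁ c≤i | inj₂ c≤j | inj₁ 2c≤i = subst (_≤ q * Y ‼ i + q * Y ‼ j) (+-comm (U + W) U)
        (+-mono-≤ (at f₂ i i< 2c≤i) (at f₁ j j< c≤j))
      ... | inj₁ c≤i | inj₂ c≤j | inj₂ 2c≤j = +-mono-≤ (at f₁ i i< c≤i) (at f₂ j j< 2c≤j)

    block₁ : ∀ {X Y} → length Y ≡ c → U ≤ q * minPairSum X → ∀ n → F₁ (twos n X Y)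
    block₁ Y≡c hX zero = from-end (≤-reflexive Y≡c)
    block₁ {X} {Y} Y≡c hX (suc n) = entries-∷ʳ (twos n X Y) (block₁ Y≡c hX n)
      (λ _ → kVal-≥ {0} X (twos n X Y) z≤n hX)

    block₂ : ∀ {X Y} → 0 < length Y → length Y ≡ c + c → W ≤ q * minPairSum X → F₁ Y →
      ∀ n → F₁ (twos n X Y) × F₂ (twos n X Y)
    block₂ Y>0 Y≡ hX f₁ zero = f₁ , from-end (≤-reflexive Y≡)
    block₂ {X} {Y} Y>0 Y≡ hX f₁ (suc n) =
      entries-∷ʳ Y′ (proj₁ ih) (λ _ → ≤-trans (m≤m+n U W) k≥) ,
      entries-∷ʳ Y′ (proj₂ ih) (λ _ → k≥)
      where
      Y′ = twos n X Y
      ih = block₂ Y>0 Y≡ hX f₁ n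
      Y≤Y′ : length Y ≤ length Y′
      Y≤Y′ = subst (length Y ≤_) (sym (twos-length n X Y)) (m≤n+m _ n)
      k≥ : U + W ≤ q * kVal X Y′
      k≥ = kVal-≥ X Y′ (pairs₁ (≤-trans Y>0 Y≤Y′) (subst (_≤ length Y′) Y≡ Y≤Y′) (proj₁ ih)) hX

    -- The first list contributes W as in `block₂`; the second now has length at least 3 c, so
    -- `pairs₂` contributes 2 U instead of U.
    block₃ : ∀ {X Y} → 0 < length Y → length Y ≡ c + c + c → W ≤ q * minPairSum X → F₁ Y → F₂ Y →
      ∀ n → F₁ (twos n X Y) × F₂ (twos n X Y) × F₃ (twos n X Y)
    block₃ Y>0 Y≡ hX f₁ f₂ zero = f₁ , f₂ , from-end (≤-reflexive Y≡)
    block₃ {X} {Y} Y>0 Y≡ hX f₁ f₂ (suc n) =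
      entries-∷ʳ Y′ (proj₁ ih) (λ _ → ≤-trans (m≤m+n U (U + W)) k≥) ,
      entries-∷ʳ Y′ (proj₁ (proj₂ ih)) (λ _ → ≤-trans (m≤n+m (U + W) U) k≥) ,
      entries-∷ʳ Y′ (proj₂ (proj₂ ih)) (λ _ → k≥)
      where
      Y′ = twos n X Y
      ih = block₃ Y>0 Y≡ hX f₁ f₂ n
      Y≤Y′ : length Y ≤ length Y′
      Y≤Y′ = subst (length Y ≤_) (sym (twos-length n X Y)) (m≤n+m _ n)
      k≥ : U + (U + W) ≤ q * kVal X Y′
      k≥ = subst (_≤ q * kVal X Y′) (+-assoc U U W)
        (kVal-≥ X Y′ (pairs₂ (≤-trans Y>0 Y≤Y′) (subst (_≤ length Y′) Y≡ Y≤Y′) (proj₁ ih) (proj₁ (proj₂ ih))) hX)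

-- Slope at least p / q, with denominators cleared.
Slope : ℕ → ℕ → List ℕ → List ℕ → Set
Slope p q X Y = Entries (λ i x → suc i * p ≤ q * (x + suc (minPairSum Y))) X

-- The two cases of the final check, for an index i below A = 33 m and below B = 43 m, with
-- s = i + 1, a = q x_i, E = q β, U + 2E = (A + 1) p and W + 2E = (B + 1) p.
module _ {m p E U W : ℕ} (100E≤mp : 100 * E ≤ m * p)
  (eU : U + (E + E) ≡ suc (33 * m) * p) (eW : W + (E + E) ≡ suc (43 * m) * p) where

  -- Write 43 = 10 + 33. The first part is covered by 10 (a + E). The second is at most 33 · 33 m p
  -- = 1089 m p, while 10 (2 U + W) supplies 10 (2 · 33 + 43) m p = 1090 m p up to 60 E; the spare m
  -- p absorbs the total error 70 E.
  slope-below-A : ∀ {s a} → s ≤ 33 * m → s * p ≤ a + E → s * (43 * p) ≤ 10 * (a + (U + (U + W)))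
  slope-below-A {s} {a} s≤ h = +-cancelʳ-≤ (60 * E) _ _ (begin
    s * (43 * p) + 60 * E ≡⟨ arith₁ s p E ⟩
    10 * (s * p) + (33 * (s * p) + 60 * E)
      ≤⟨ +-mono-≤ (*-monoʳ-≤ 10 h) (+-monoˡ-≤ _ (*-monoʳ-≤ 33 (*-monoˡ-≤ p s≤))) ⟩
    10 * (a + E) + (33 * (33 * m * p) + 60 * E) ≡⟨ arith₂ a E m p ⟩
    10 * a + (1089 * (m * p) + 70 * E)
      ≤⟨ +-monoʳ-≤ (10 * a) (+-monoʳ-≤ (1089 * (m * p)) (≤-trans (*-monoˡ-≤ E (m≤m+n 70 30)) 100E≤mp)) ⟩
    10 * a + (1089 * (m * p) + m * p) ≤⟨ m≤m+n _ (30 * p) ⟩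
    10 * a + (1089 * (m * p) + m * p) + 30 * p ≡⟨ arith₃ a m p ⟩
    10 * (a + (suc (33 * m) * p + suc (33 * m) * p + suc (43 * m) * p))
      ≡⟨ cong₃ (λ u v w → 10 * (a + (u + v + w))) (sym eU) (sym eU) (sym eW) ⟩
    10 * (a + (U + (E + E) + (U + (E + E)) + (W + (E + E)))) ≡⟨ arith₄ a U W E ⟩
    10 * (a + (U + (U + W))) + 60 * E ∎)
    where
    open ≤-Reasoning
    cong₃ : ∀ (f : ℕ → ℕ → ℕ → ℕ) {u u′ v v′ w w′} → u ≡ u′ → v ≡ v′ → w ≡ w′ → f u v w ≡ f u′ v′ w′
    cong₃ f refl refl refl = refl
    arith₁ : ∀ s p E → s * (43 * p) + 60 * E ≡ 10 * (s * p) + (33 * (s * p) + 60 * E)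
    arith₁ = solve-∀
    arith₂ : ∀ a E m p → 10 * (a + E) + (33 * (33 * m * p) + 60 * E) ≡ 10 * a + (1089 * (m * p) + 70 * E)
    arith₂ = solve-∀
    arith₃ : ∀ a m p → 10 * a + (1089 * (m * p) + m * p) + 30 * p ≡
      10 * (a + (suc (33 * m) * p + suc (33 * m) * p + suc (43 * m) * p))
    arith₃ = solve-∀
    arith₄ : ∀ a U W E → 10 * (a + (U + (E + E) + (U + (E + E)) + (W + (E + E)))) ≡
      10 * (a + (U + (U + W))) + 60 * E
    arith₄ = solve-∀

  -- As for A, with the gain U: now 33 · 43 = 1419 stands against 10 (3 · 33 + 43) = 1420. The total
  -- error is 100 E, which explains the hypothesis on m.
  slope-below-B : ∀ {s a} → s ≤ 43 * m → U + s * p ≤ a + (E + E) →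
    s * (43 * p) ≤ 10 * (a + (U + (U + W)))
  slope-below-B {s} {a} s≤ h = +-cancelʳ-≤ (10 * U + 80 * E) _ _ (begin
    s * (43 * p) + (10 * U + 80 * E) ≡⟨ arith₁ s p U E ⟩
    10 * (U + s * p) + (33 * (s * p) + 80 * E)
      ≤⟨ +-mono-≤ (*-monoʳ-≤ 10 h) (+-monoˡ-≤ _ (*-monoʳ-≤ 33 (*-monoˡ-≤ p s≤))) ⟩
    10 * (a + (E + E)) + (33 * (43 * m * p) + 80 * E) ≡⟨ arith₂ a E m p ⟩
    10 * a + (1419 * (m * p) + 100 * E)
      ≤⟨ +-monoʳ-≤ (10 * a) (+-monoʳ-≤ (1419 * (m * p)) 100E≤mp) ⟩
    10 * a + (1419 * (m * p) + m * p) ≤⟨ m≤m+n _ (40 * p) ⟩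
    10 * a + (1419 * (m * p) + m * p) + 40 * p ≡⟨ arith₃ a m p ⟩
    10 * (a + (3 * (suc (33 * m) * p) + suc (43 * m) * p))
      ≡⟨ cong₂ (λ u w → 10 * (a + (3 * u + w))) (sym eU) (sym eW) ⟩
    10 * (a + (3 * (U + (E + E)) + (W + (E + E)))) ≡⟨ arith₄ a U W E ⟩
    10 * (a + (U + (U + W))) + (10 * U + 80 * E) ∎)
    where
    open ≤-Reasoning
    arith₁ : ∀ s p U E → s * (43 * p) + (10 * U + 80 * E) ≡ 10 * (U + s * p) + (33 * (s * p) + 80 * E)
    arith₁ = solve-∀
    arith₂ : ∀ a E m p → 10 * (a + (E + E)) + (33 * (43 * m * p) + 80 * E) ≡ 10 * a + (1419 * (m * p) + 100 * E)
    arith₂ = solve-∀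
    arith₃ : ∀ a m p → 10 * a + (1419 * (m * p) + m * p) + 40 * p ≡
      10 * (a + (3 * (suc (33 * m) * p) + suc (43 * m) * p))
    arith₃ = solve-∀
    arith₄ : ∀ a U W E → 10 * (a + (3 * (U + (E + E)) + (W + (E + E)))) ≡
      10 * (a + (U + (U + W))) + (10 * U + 80 * E)
    arith₄ = solve-∀

Steep : ℕ → ℕ → ℕ → Set
Steep c p q = ∃₂ λ X Y → Reach X Y × length Y ≡ c × Slope p q X Y

-- `Y` is the second list before the final symbol 2, so that the word ends as the definition of δ(c)
-- demands.
SteepLastTwo : ℕ → ℕ → ℕ → Set
SteepLastTwo c p q = ∃₂ λ X Y → Reach X Y × suc (length Y) ≡ c × Slope p q X (Y ++ [ kVal X Y ])

forget-last : ∀ {c p q} → SteepLastTwo c p q → Steep c p q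
forget-last (X , Y , r , eq , h) = X , Y ++ [ kVal X Y ] , addTwo r , trans (length-∷ʳ Y) eq , h

-- A = 33 m and B = 43 m in the application; E = q β, U and W are lower bounds scaled by q, so that the
-- four blocks of the second list are bounded below by 0, U, U + W and 2U + W.
module Quadruple {p q c′ : ℕ} {X Y : List ℕ} (r : Reach X Y) (Y≡ : length Y ≡ suc c′) (e : ℕ)
  {E A B U W : ℕ} (h : Scaled.Superlinear p q E X) (E≤ : E ≤ q * suc (minPairSum Y))
  (X≤A : length X ≤ A) (A≤B : A ≤ B) (eU : U + (E + E) ≡ suc A * p) (eW : W + (E + E) ≡ suc B * p)
  (E≤U : E ≤ U) (U≤W : U ≤ W)
  (below-A : ∀ {s a} → s ≤ A → s * p ≤ a + E → s * (43 * p) ≤ 10 * (a + (U + (U + W))))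
  (below-B : ∀ {s a} → s ≤ B → U + s * p ≤ a + (E + E) → s * (43 * p) ≤ 10 * (a + (U + (U + W))))
  where

  open Scaled p q
  open Blocks (suc c′) U W U≤W

  c : ℕ
  c = suc c′

  X₀ X₁ Y₁ Y₂ Y₃ Y₄ : List ℕ
  X₀ = ones (A ∸ length X) X Y
  Y₁ = twos c X₀ Y
  X₁ = ones (B ∸ A) X₀ Y₁
  Y₂ = twos c X₁ Y₁
  -- The last block has c + e entries, so the padding `e` reaches every length from 4 c on; `Y₃`
  -- lacks only its final entry.
  Y₃ = twos (c′ + e) X₁ Y₂
  Y₄ = twos (suc (c′ + e)) X₁ Y₂

  X₀≡ : length X₀ ≡ A
  X₀≡ = trans (ones-length (A ∸ length X) X Y) (m∸n+n≡m X≤A)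
  X₁≡ : length X₁ ≡ B
  X₁≡ = trans (ones-length (B ∸ A) X₀ Y₁) (trans (cong (_+_ (B ∸ A)) X₀≡) (m∸n+n≡m A≤B))
  Y₁≡ : length Y₁ ≡ c + c
  Y₁≡ = trans (twos-length c X₀ Y) (cong (_+_ c) Y≡)
  Y₂≡ : length Y₂ ≡ c + c + c
  Y₂≡ = trans (twos-length c X₁ Y₁) (trans (cong (_+_ c) Y₁≡) (sym (+-assoc c c c)))
  Y₃≡ : suc (length Y₃) ≡ 4 * c + e
  Y₃≡ = trans (cong suc (trans (twos-length (c′ + e) X₁ Y₂) (cong (_+_ (c′ + e)) Y₂≡))) (arith c′ e)
    where
    arith : ∀ c′ e → suc (c′ + e + (suc c′ + suc c′ + suc c′)) ≡ 4 * suc c′ + e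
    arith = solve-∀
  Y₁>0 : 0 < length Y₁
  Y₁>0 = subst (0 <_) (sym Y₁≡) z<s
  Y₂>0 : 0 < length Y₂
  Y₂>0 = subst (0 <_) (sym Y₂≡) z<s

  r₁ : Reach X₀ Y₁
  r₁ = twos-Reach c (ones-Reach (A ∸ length X) r)
  r₃ : Reach X₁ Y₃
  r₃ = twos-Reach (c′ + e) (twos-Reach c (ones-Reach (B ∸ A) r₁))
  X₀>0 : 0 < length X₀
  X₀>0 = Reach-X>0 r₁
  X₁>0 : 0 < length X₁
  X₁>0 = Reach-X>0 r₃

  h₀ : Superlinear E X₀
  h₀ = ones-superlinear E≤ (Reach-X>0 r) h (A ∸ length X)
  U≤PX₀ : U ≤ q * minPairSum X₀
  U≤PX₀ = +-cancelʳ-≤ (E + E) _ _ (≤-trans (≤-reflexive eU)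
    (subst (λ n → suc n * p ≤ q * minPairSum X₀ + (E + E)) X₀≡ (superlinear-pairs X₀>0 h₀)))
  f₁ : F₁ Y₁
  f₁ = block₁ Y≡ U≤PX₀ c
  U≤PY₁ : U ≤ q * suc (minPairSum Y₁)
  U≤PY₁ = ≤-trans (pairs₁ Y₁>0 (≤-reflexive (sym Y₁≡)) f₁) (*-monoʳ-≤ q (n≤1+n _))
  h₁ : Superlinear E X₁
  h₁ = ones-superlinear (≤-trans E≤U U≤PY₁) X₀>0 h₀ (B ∸ A)
  g₁ : Entries (λ i x → A ≤ i → U + suc i * p ≤ q * x + (E + E)) X₁
  g₁ = ones-gain E≤U U≤PY₁ X₀>0 (≤-reflexive X₀≡) h₀ (B ∸ A)
  W≤PX₁ : W ≤ q * minPairSum X₁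
  W≤PX₁ = +-cancelʳ-≤ (E + E) _ _ (≤-trans (≤-reflexive eW)
    (subst (λ n → suc n * p ≤ q * minPairSum X₁ + (E + E)) X₁≡ (superlinear-pairs X₁>0 h₁)))
  f₂ : F₁ Y₂ × F₂ Y₂
  f₂ = block₂ Y₁>0 Y₁≡ W≤PX₁ f₁ c
  f₃ : F₁ Y₄ × F₂ Y₄ × F₃ Y₄
  f₃ = block₃ Y₂>0 Y₂≡ W≤PX₁ (proj₁ f₂) (proj₂ f₂) (suc (c′ + e))

  Y₄≥ : c + c + c + c ≤ length Y₄
  Y₄≥ = begin
    c + c + c + c ≡⟨ +-comm (c + c + c) c ⟩
    c + (c + c + c) ≤⟨ +-monoˡ-≤ (c + c + c) (s≤s (m≤m+n c′ e)) ⟩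
    suc (c′ + e) + (c + c + c) ≡⟨ cong (_+_ (suc (c′ + e))) (sym Y₂≡) ⟩
    suc (c′ + e) + length Y₂ ≡⟨ sym (twos-length (suc (c′ + e)) X₁ Y₂) ⟩
    length Y₄ ∎
    where open ≤-Reasoning
  β≥ : U + (U + W) ≤ q * suc (minPairSum Y₄)
  β≥ = ≤-trans (pairs₃ (≤-trans z<s Y₄≥) Y₄≥ (proj₁ f₃) (proj₁ (proj₂ f₃)) (proj₂ (proj₂ f₃)))
    (*-monoʳ-≤ q (n≤1+n _))

  enough : ∀ {z} x → z ≤ 10 * (q * x + (U + (U + W))) → z ≤ 10 * q * (x + suc (minPairSum Y₄))
  enough {z} x z≤ = begin
    z ≤⟨ z≤ ⟩
    10 * (q * x + (U + (U + W))) ≤⟨ *-monoʳ-≤ 10 (+-monoʳ-≤ (q * x) β≥) ⟩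
    10 * (q * x + q * suc (minPairSum Y₄)) ≡⟨ cong (10 *_) (sym (*-distribˡ-+ q x _)) ⟩
    10 * (q * (x + suc (minPairSum Y₄))) ≡⟨ sym (*-assoc 10 q _) ⟩
    10 * q * (x + suc (minPairSum Y₄)) ∎
    where open ≤-Reasoning

  slope : Slope (43 * p) (10 * q) X₁ Y₄
  slope = entries go
    where
    go : ∀ i → i < length X₁ → suc i * (43 * p) ≤ 10 * q * (X₁ ‼ i + suc (minPairSum Y₄))
    -- Below A only the linear bound is at hand; indices from A to B - 1 were added after the block
    -- `Y₁` and carry the gain U.
    go i i< with suc i ≤? A
    ... | yes i<A = enough (X₁ ‼ i) (below-A {suc i} {q * X₁ ‼ i} i<A (at h₁ i i<))
    ... | no i≮A = enough (X₁ ‼ i) (below-B {suc i} {q * X₁ ‼ i} (subst (i <_) X₁≡ i<) (at g₁ i i< (≮⇒≥ i≮A)))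

  result : SteepLastTwo (4 * c + e) (43 * p) (10 * q)
  result = X₁ , Y₃ , r₃ , Y₃≡ , slope

quadruple : ∀ {c p q} → 1 ≤ p → Steep c p q → ∀ e → SteepLastTwo (4 * c + e) (43 * p) (10 * q)
quadruple {zero} _ (X , Y , r , Y≡ , h) e = ⊥-elim (<⇒≱ (Reach-Y>0 r) (≤-reflexive Y≡))
quadruple {suc c′} {p} {q} 1≤p (X , Y , r , Y≡ , h) e =
  -- This m ensures both 100 E ≤ m p and `length X` ≤ 33 m. `E` and `m` enter through equations so
  -- that they stay opaque in the arithmetic.
  choose (q * suc (minPairSum Y)) (100 * (q * suc (minPairSum Y)) + length X) refl refl
  where
  choose : ∀ E m → E ≡ q * suc (minPairSum Y) → m ≡ 100 * E + length X →
    SteepLastTwo (4 * suc c′ + e) (43 * p) (10 * q)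
  choose E m E≡ m≡ = Quadruple.result {p} {q} r Y≡ e {E} {33 * m} {43 * m} {U} {W}
    (entries-map (λ {i} {x} _ → subst (suc i * p ≤_)
      (trans (*-distribˡ-+ q x _) (cong (_+_ (q * x)) (sym E≡)))) h)
    (≤-reflexive E≡) X≤A A≤B eU eW E≤U (∸-monoˡ-≤ (E + E) sA≤sB)
    (λ {s} {a} → slope-below-A {m} {p} {E} {U} {W} 100E≤mp eU eW {s} {a})
    (λ {s} {a} → slope-below-B {m} {p} {E} {U} {W} 100E≤mp eU eW {s} {a})
    where
    open ≤-Reasoning
    U W : ℕ
    U = suc (33 * m) * p ∸ (E + E)
    W = suc (43 * m) * p ∸ (E + E)
    A≤B : 33 * m ≤ 43 * m
    A≤B = *-monoˡ-≤ m (m≤m+n 33 10)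
    m≤A : m ≤ 33 * m
    m≤A = m≤m+n m (32 * m)
    X≤A : length X ≤ 33 * m
    X≤A = ≤-trans (subst (length X ≤_) (sym m≡) (m≤n+m _ (100 * E))) m≤A
    100E≤mp : 100 * E ≤ m * p
    100E≤mp = begin
      100 * E ≤⟨ m≤m+n (100 * E) (length X) ⟩
      100 * E + length X ≡⟨ sym m≡ ⟩
      m ≡⟨ sym (*-identityʳ m) ⟩
      m * 1 ≤⟨ *-monoʳ-≤ m 1≤p ⟩
      m * p ∎
    3E≤ : E + E + E ≤ suc (33 * m) * p
    3E≤ = begin
      E + E + E ≤⟨ m≤m+n _ (97 * E) ⟩
      E + E + E + 97 * E ≡⟨ arith E ⟩
      100 * E ≤⟨ 100E≤mp ⟩
      m * p ≤⟨ *-monoˡ-≤ p (≤-trans m≤A (n≤1+n _)) ⟩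
      suc (33 * m) * p ∎
      where
      arith : ∀ E → E + E + E + 97 * E ≡ 100 * E
      arith = solve-∀
    2E≤ : E + E ≤ suc (33 * m) * p
    2E≤ = ≤-trans (m≤m+n _ E) 3E≤
    sA≤sB : suc (33 * m) * p ≤ suc (43 * m) * p
    sA≤sB = *-monoˡ-≤ p (s≤s A≤B)
    eU : U + (E + E) ≡ suc (33 * m) * p
    eU = m∸n+n≡m 2E≤
    eW : W + (E + E) ≡ suc (43 * m) * p
    eW = m∸n+n≡m (≤-trans 2E≤ sA≤sB)
    E≤U : E ≤ U
    E≤U = m+n≤o⇒m≤o∸n E (subst (_≤ suc (33 * m) * p) (+-assoc E E E) 3E≤)

steep-4^ : ∀ t → Steep (4 ^ t) (43 ^ t) (10 ^ t)
-- The initial state has β = 1 and the single ratio 1.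
steep-4^ zero = [ 0 ] , [ 0 ] , start , refl , entries-[0] ≤-refl
steep-4^ (suc t) = subst (λ c → Steep c (43 ^ suc t) (10 ^ suc t)) (+-identityʳ (4 ^ suc t))
  (forget-last {p = 43 ^ suc t} {10 ^ suc t} (quadruple {4 ^ t} {43 ^ t} {10 ^ t} (m^n>0 43 t) (steep-4^ t) 0))

-- Passage to rational numbers

-- `_/_` reduces to lowest terms; in the unnormalised rationals order and product need no gcd.
toℚᵘ-/ : ∀ a n → toℚᵘ (+ a / suc n) ℚᵘ.≃ mkℚᵘ (+ a) n
toℚᵘ-/ a n = ℚ.toℚᵘ-fromℚᵘ (mkℚᵘ (+ a) n)

/-mono-≤ : ∀ a b m n .{{_ : NonZero m}} .{{_ : NonZero n}} → a * n ≤ b * m → + a / m ℚ.≤ + b / n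
/-mono-≤ a b (suc m) (suc n) h = ℚ.toℚᵘ-cancel-≤ (begin
  toℚᵘ (+ a / suc m) ≃⟨ toℚᵘ-/ a m ⟩
  mkℚᵘ (+ a) m ≤⟨ *≤* (subst₂ ℤ._≤_ (ℤ.pos-* a (suc n)) (ℤ.pos-* b (suc m)) (+≤+ h)) ⟩
  mkℚᵘ (+ b) n ≃⟨ ℚᵘ.≃-sym (toℚᵘ-/ b n) ⟩
  toℚᵘ (+ b / suc n) ∎)
  where open ℚᵘ.≤-Reasoning

/-* : ∀ a b m n .{{_ : NonZero m}} .{{_ : NonZero n}} .{{_ : NonZero (m * n)}} →
  (+ a / m) ℚ.* (+ b / n) ≡ + (a * b) / (m * n)
/-* a b (suc m) (suc n) = ℚ.toℚᵘ-injective (begin-equality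
  toℚᵘ ((+ a / suc m) ℚ.* (+ b / suc n)) ≃⟨ ℚ.toℚᵘ-homo-* (+ a / suc m) (+ b / suc n) ⟩
  toℚᵘ (+ a / suc m) ℚᵘ.* toℚᵘ (+ b / suc n) ≃⟨ ℚᵘ.*-cong (toℚᵘ-/ a m) (toℚᵘ-/ b n) ⟩
  mkℚᵘ (+ a) m ℚᵘ.* mkℚᵘ (+ b) n ≡⟨ cong (λ z → mkℚᵘ z (n + m * suc n)) (sym (ℤ.pos-* a b)) ⟩
  mkℚᵘ (+ (a * b)) (n + m * suc n) ≃⟨ ℚᵘ.≃-sym (toℚᵘ-/ (a * b) (n + m * suc n)) ⟩
  toℚᵘ (+ (a * b) / (suc m * suc n)) ∎)
  where open ℚᵘ.≤-Reasoning

/-^ : ∀ a n k .{{_ : NonZero n}} .{{_ : NonZero (n ^ k)}} → (+ a / n) ^ℚ k ≡ + (a ^ k) / (n ^ k)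
/-^ a n zero = refl
/-^ a n (suc k) = trans (cong ((+ a / n) ℚ.*_) (/-^ a n k)) (/-* a (a ^ k) n (n ^ k))
  where
  instance
    n^k≢0 : NonZero (n ^ k)
    n^k≢0 = m^n≢0 n k

^ℚ-nonNeg : ∀ {p} → 0ℚ ℚ.≤ p → ∀ n → 0ℚ ℚ.≤ p ^ℚ n
^ℚ-nonNeg 0≤p zero = /-mono-≤ 0 1 1 1 z≤n
^ℚ-nonNeg {p} 0≤p (suc n) = ℚ.nonNegative⁻¹ _
  {{ℚ.nonNeg*nonNeg⇒nonNeg p {{ℚ.nonNegative 0≤p}} (p ^ℚ n) {{ℚ.nonNegative (^ℚ-nonNeg 0≤p n)}}}}

^ℚ-mono-≤ : ∀ {p q} → 0ℚ ℚ.≤ p → p ℚ.≤ q → ∀ n → p ^ℚ n ℚ.≤ q ^ℚ n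
^ℚ-mono-≤ 0≤p p≤q zero = ℚ.≤-refl
^ℚ-mono-≤ {p} {q} 0≤p p≤q (suc n) = ℚ.≤-trans
  (ℚ.*-monoˡ-≤-nonNeg p {{ℚ.nonNegative 0≤p}} (^ℚ-mono-≤ 0≤p p≤q n))
  (ℚ.*-monoʳ-≤-nonNeg (q ^ℚ n) {{ℚ.nonNegative (^ℚ-nonNeg (ℚ.≤-trans 0≤p p≤q) n)}} p≤q)

minℚ-≥ : ∀ {q r} rs → q ℚ.≤ r → All (q ℚ.≤_) rs → q ℚ.≤ minℚ r rs
minℚ-≥ [] q≤r [] = q≤r
minℚ-≥ (r′ ∷ rs) q≤r (q≤r′ ∷ h) = ℚ.⊓-glb q≤r (minℚ-≥ rs q≤r′ h)

minℚ-≤ : ∀ {q r} rs → Any (ℚ._≤ q) (r ∷ rs) → minℚ r rs ℚ.≤ q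
minℚ-≤ [] (here r≤q) = r≤q
minℚ-≤ (r′ ∷ rs) (here r≤q) = ℚ.≤-trans (ℚ.p⊓q≤p _ (minℚ r′ rs)) r≤q
minℚ-≤ {r = r} (r′ ∷ rs) (there h) = ℚ.≤-trans (ℚ.p⊓q≤q r _) (minℚ-≤ rs h)

ratios-All : ∀ {q} b j L → (∀ i → i < length L → q ℚ.≤ + (L ‼ i + b) / suc (j + i)) →
  All (q ℚ.≤_) (ratios b j L)
ratios-All b j [] h = []
ratios-All {q} b j (x ∷ L) h =
  subst (λ k → q ℚ.≤ + (x + b) / suc k) (+-identityʳ j) (h 0 z<s) ∷
  ratios-All b (suc j) L
    (λ i i< → subst (λ k → q ℚ.≤ + (L ‼ i + b) / suc k) (+-suc j i) (h (suc i) (s<s i<)))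

ratios-Any : ∀ {q} b j L i → i < length L → + (L ‼ i + b) / suc (j + i) ℚ.≤ q →
  Any (ℚ._≤ q) (ratios b j L)
ratios-Any {q} b j (x ∷ L) zero _ h =
  here (subst (λ k → + (x + b) / suc k ℚ.≤ q) (+-identityʳ j) h)
ratios-Any {q} b j (x ∷ L) (suc i) (s≤s i<) h = there (ratios-Any b (suc j) L i i<
  (subst (λ k → + (L ‼ i + b) / suc k ℚ.≤ q) (+-suc j i) h))

ratios>0 : ∀ b j L → 0 < length L → 0 < length (ratios b j L)
ratios>0 b j (x ∷ L) _ = z<s

δα-≥ : ∀ {q} α → 0 < length (xs₁ α) →
  (∀ i → i < length (xs₁ α) → q ℚ.≤ + (xs₁ α ‼ i + βα α) / suc i) → q ℚ.≤ δα α
-- Abstracting `ratios` together with its nonemptiness excludes the default value of `δα`.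
δα-≥ α >0 h with ratios (βα α) 0 (xs₁ α) | ratios>0 (βα α) 0 (xs₁ α) >0 | ratios-All (βα α) 0 (xs₁ α) h
... | r ∷ rs | _ | q≤r ∷ q≤rs = minℚ-≥ rs q≤r q≤rs

δα-≤ : ∀ {q} α i → i < length (xs₁ α) → + (xs₁ α ‼ i + βα α) / suc i ℚ.≤ q → δα α ℚ.≤ q
δα-≤ α i i< h with ratios (βα α) 0 (xs₁ α) | ratios-Any (βα α) 0 (xs₁ α) i i< h
... | r ∷ rs | any = minℚ-≤ rs any

δα-nonNeg : ∀ α → 0ℚ ℚ.≤ δα α
δα-nonNeg α = δα-≥ α (Reach-X>0 (run-Reach α start)) (λ i _ → /-mono-≤ 0 (xs₁ α ‼ i + βα α) 1 (suc i) z≤n)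

-- Integer logarithms and growth exponents

log-bracket : ∀ b → 2 ≤ b → ∀ c → 1 ≤ c → ∃[ t ] (b ^ t ≤ c × c < b ^ suc t)
log-bracket b 2≤b (suc zero) _ = 0 , ≤-refl , subst (1 <_) (sym (*-identityʳ b)) 2≤b
log-bracket b 2≤b (suc (suc c)) _ with log-bracket b 2≤b (suc c) z<s
... | t , lo , hi with suc (suc c) <? b ^ suc t
... | yes lt = t , m≤n⇒m≤1+n lo , lt
... | no ≮ = suc t , ≮⇒≥ ≮ , (begin-strict
  suc (suc c) ≤⟨ hi ⟩
  b ^ suc t <⟨ ^-monoʳ-< b 2≤b (n<1+n (suc t)) ⟩
  b ^ suc (suc t) ∎)
  where open ≤-Reasoning

^-distribʳ-* : ∀ n a b → (a * b) ^ n ≡ a ^ n * b ^ n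
^-distribʳ-* zero a b = refl
^-distribʳ-* (suc n) a b = trans (cong (a * b *_) (^-distribʳ-* n a b)) (arith a b (a ^ n) (b ^ n))
  where
  arith : ∀ a b x y → a * b * (x * y) ≡ a * x * (b * y)
  arith = solve-∀

^-swap : ∀ a m n → (a ^ m) ^ n ≡ (a ^ n) ^ m
^-swap a m n = trans (^-*-assoc a m n) (trans (cong (a ^_) (*-comm m n)) (sym (^-*-assoc a n m)))

-- Growth of order c^(n/m) is expressed without roots, by comparing an m-th power with an n-th
-- power.
power-lower : ∀ {x} p q c K m n .{{_ : NonZero q}} .{{_ : NonZero K}} → + p / q ℚ.≤ x →
  c ^ n * q ^ m ≤ p ^ m * K → (+ 1 / K) ℚ.* ((+ c / 1) ^ℚ n) ℚ.≤ x ^ℚ m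
power-lower {x} p q c K m n h c≤p = begin
  (+ 1 / K) ℚ.* ((+ c / 1) ^ℚ n) ≡⟨ cong ((+ 1 / K) ℚ.*_) (/-^ c 1 n) ⟩
  (+ 1 / K) ℚ.* (+ (c ^ n) / (1 ^ n)) ≡⟨ /-* 1 (c ^ n) K (1 ^ n) ⟩
  + (1 * c ^ n) / (K * 1 ^ n) ≤⟨ /-mono-≤ (1 * c ^ n) (p ^ m) (K * 1 ^ n) (q ^ m) powers ⟩
  + (p ^ m) / (q ^ m) ≡⟨ sym (/-^ p q m) ⟩
  (+ p / q) ^ℚ m ≤⟨ ^ℚ-mono-≤ (/-mono-≤ 0 p 1 q z≤n) h m ⟩
  x ^ℚ m ∎
  where
  open ℚ.≤-Reasoning
  instance
    1^n≢0 : NonZero (1 ^ n)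
    1^n≢0 = m^n≢0 1 n
    q^m≢0 : NonZero (q ^ m)
    q^m≢0 = m^n≢0 q m
    K1^n≢0 : NonZero (K * 1 ^ n)
    K1^n≢0 = m*n≢0 K (1 ^ n)
  powers : 1 * c ^ n * q ^ m ≤ p ^ m * (K * 1 ^ n)
  powers rewrite ^-zeroˡ n | *-identityʳ K | *-identityˡ (c ^ n) = c≤p

power-upper : ∀ {x} d c K m n → 0ℚ ℚ.≤ x → x ℚ.≤ + d / 1 → d ^ m ≤ K * c ^ n →
  x ^ℚ m ℚ.≤ (+ K / 1) ℚ.* ((+ c / 1) ^ℚ n)
power-upper {x} d c K m n 0≤x h d≤c = begin
  x ^ℚ m ≤⟨ ^ℚ-mono-≤ 0≤x h m ⟩
  (+ d / 1) ^ℚ m ≡⟨ /-^ d 1 m ⟩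
  + (d ^ m) / (1 ^ m) ≤⟨ /-mono-≤ (d ^ m) (K * c ^ n) (1 ^ m) (1 * 1 ^ n) powers ⟩
  + (K * c ^ n) / (1 * 1 ^ n) ≡⟨ sym (/-* K (c ^ n) 1 (1 ^ n)) ⟩
  (+ K / 1) ℚ.* (+ (c ^ n) / (1 ^ n)) ≡⟨ cong ((+ K / 1) ℚ.*_) (sym (/-^ c 1 n)) ⟩
  (+ K / 1) ℚ.* ((+ c / 1) ^ℚ n) ∎
  where
  open ℚ.≤-Reasoning
  instance
    1^m≢0 : NonZero (1 ^ m)
    1^m≢0 = m^n≢0 1 m
    1^n≢0 : NonZero (1 ^ n)
    1^n≢0 = m^n≢0 1 n
    11^n≢0 : NonZero (1 * 1 ^ n)
    11^n≢0 = m*n≢0 1 (1 ^ n)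
  powers : d ^ m * (1 * 1 ^ n) ≤ K * c ^ n * 1 ^ m
  powers rewrite ^-zeroˡ n | ^-zeroˡ m | *-identityʳ (d ^ m) | *-identityʳ (K * c ^ n) = d≤c

-- The hypothesis says that the logarithm of a / d to base b is at least n / m; its s-th power
-- handles b^s, and the factor b^n pays for rounding c up to b^(s+1).
growth-lower : ∀ {a b d c} m n s → b ^ n * d ^ m ≤ a ^ m → c ≤ b * b ^ s →
  c ^ n * (d ^ s) ^ m ≤ (a ^ s) ^ m * b ^ n
growth-lower {a} {b} {d} {c} m n s h c≤ = begin
  c ^ n * (d ^ s) ^ m ≤⟨ *-monoˡ-≤ _ (^-monoˡ-≤ n c≤) ⟩
  (b * b ^ s) ^ n * (d ^ s) ^ m ≡⟨ cong₂ _*_ (^-distribʳ-* n b (b ^ s)) (^-swap d s m) ⟩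
  b ^ n * (b ^ s) ^ n * (d ^ m) ^ s ≡⟨ cong (λ z → b ^ n * z * (d ^ m) ^ s) (^-swap b s n) ⟩
  b ^ n * (b ^ n) ^ s * (d ^ m) ^ s ≡⟨ arith (b ^ n) ((b ^ n) ^ s) ((d ^ m) ^ s) ⟩
  (b ^ n) ^ s * (d ^ m) ^ s * b ^ n ≡⟨ cong (_* b ^ n) (sym (^-distribʳ-* s (b ^ n) (d ^ m))) ⟩
  (b ^ n * d ^ m) ^ s * b ^ n ≤⟨ *-monoˡ-≤ (b ^ n) (^-monoˡ-≤ s h) ⟩
  (a ^ m) ^ s * b ^ n ≡⟨ cong (_* b ^ n) (^-swap a m s) ⟩
  (a ^ s) ^ m * b ^ n ∎
  where
  open ≤-Reasoning
  arith : ∀ k x y → k * x * y ≡ x * y * k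
  arith = solve-∀

-- In the constant, b^m stems from the leading factor b and b^n from rounding c to a power of b.
growth-upper : ∀ {a b c} m n s → a ^ m ≤ b ^ n → b ^ s ≤ b * c →
  (b * a ^ s) ^ m ≤ b ^ (m + n) * c ^ n
growth-upper {a} {b} {c} m n s h ≤c = begin
  (b * a ^ s) ^ m ≡⟨ ^-distribʳ-* m b (a ^ s) ⟩
  b ^ m * (a ^ s) ^ m ≡⟨ cong (b ^ m *_) (^-swap a s m) ⟩
  b ^ m * (a ^ m) ^ s ≤⟨ *-monoʳ-≤ (b ^ m) (^-monoˡ-≤ s h) ⟩
  b ^ m * (b ^ n) ^ s ≡⟨ cong (b ^ m *_) (^-swap b n s) ⟩
  b ^ m * (b ^ s) ^ n ≤⟨ *-monoʳ-≤ (b ^ m) (^-monoˡ-≤ n ≤c) ⟩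
  b ^ m * (b * c) ^ n ≡⟨ cong (b ^ m *_) (^-distribʳ-* n b c) ⟩
  b ^ m * (b ^ n * c ^ n) ≡⟨ sym (*-assoc (b ^ m) (b ^ n) (c ^ n)) ⟩
  b ^ m * b ^ n * c ^ n ≡⟨ cong (_* c ^ n) (sym (^-distribˡ-+-* b m n)) ⟩
  b ^ (m + n) * c ^ n ∎
  where open ≤-Reasoning

-- Bounds on δ(α) for words

SteepLastTwo-δα : ∀ c p q .{{_ : NonZero q}} → SteepLastTwo c p q →
  ∃[ α ] (count two α + 1 ≡ c × LastIsTwo α × + p / q ℚ.≤ δα α)
SteepLastTwo-δα c p q (X , Y , r , Y≡ , h) with Reach-run r
... | w , run≡ = α , length-c , last-two w , δα-≥ α X>0 ratio
  where
  α : List Sym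
  α = w ++ [ two ]
  Y⁺ : List ℕ
  Y⁺ = Y ++ [ kVal X Y ]
  run-α : run α [ 0 ] [ 0 ] ≡ (X , Y⁺)
  run-α = trans (run-++ w [ two ] [ 0 ] [ 0 ]) (cong (λ s → run [ two ] (proj₁ s) (proj₂ s)) run≡)
  xs₁≡ : xs₁ α ≡ X
  xs₁≡ = cong proj₁ run-α
  βα≡ : βα α ≡ suc (minPairSum Y⁺)
  βα≡ = cong (λ s → suc (minPairSum (proj₂ s))) run-α
  X>0 : 0 < length (xs₁ α)
  X>0 = subst (λ L → 0 < length L) (sym xs₁≡) (Reach-X>0 r)
  length-c : count two α + 1 ≡ c
  length-c = trans (sym (run-length α [ 0 ] [ 0 ])) (trans (cong (λ s → length (proj₂ s)) run-α)
    (trans (length-∷ʳ Y) Y≡))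
  ratio : ∀ i → i < length (xs₁ α) → + p / q ℚ.≤ + (xs₁ α ‼ i + βα α) / suc i
  ratio i i< = /-mono-≤ p (xs₁ α ‼ i + βα α) q (suc i) (begin
    p * suc i ≡⟨ *-comm p (suc i) ⟩
    suc i * p ≤⟨ at h i (subst (λ L → i < length L) xs₁≡ i<) ⟩
    q * (X ‼ i + suc (minPairSum Y⁺)) ≡⟨ cong₂ (λ L b → q * (L ‼ i + b)) (sym xs₁≡) (sym βα≡) ⟩
    q * (xs₁ α ‼ i + βα α) ≡⟨ *-comm q _ ⟩
    (xs₁ α ‼ i + βα α) * q ∎)
    where open ≤-Reasoning

δα-bounded : ∀ {D N} α → Bounded N D → count two α + 1 < N → δα α ℚ.≤ + (2 * D) / 1
δα-bounded {D} {N} α B c<N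
  with last-ratio-bounded {N} {D} B (run-Reach α start) (subst (_< N) (sym (run-length α [ 0 ] [ 0 ])) c<N)
... | j , j< , h = δα-≤ α j j<
  (/-mono-≤ (xs₁ α ‼ j + βα α) (2 * D) (suc j) 1 (≤-trans (≤-reflexive (*-identityʳ _)) h))

-- For 4^(t+1) ≤ c < 4^(t+2), the last of t + 1 quadruplings takes c - 4^(t+1) as padding. Since c ≥
-- 4 there is at least one quadrupling, which makes the word end in 2.
steep-sequence : ∀ c → 4 ≤ c → ∃[ s ] ∃[ α ] (c ≤ 4 * 4 ^ s × count two α + 1 ≡ c × LastIsTwo α ×
  _/_ (+ (43 ^ s)) (10 ^ s) {{m^n≢0 10 s}} ℚ.≤ δα α)
steep-sequence c 4≤c with log-bracket 4 (s≤s (s≤s z≤n)) c (≤-trans (s≤s z≤n) 4≤c)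
... | zero , _ , c<4 = ⊥-elim (<⇒≱ c<4 4≤c)
... | suc t , 4^≤c , c<4^
  with SteepLastTwo-δα (4 * 4 ^ t + (c ∸ 4 * 4 ^ t)) (43 * 43 ^ t) (10 * 10 ^ t) {{m^n≢0 10 (suc t)}}
    (quadruple {4 ^ t} {43 ^ t} {10 ^ t} (m^n>0 43 t) (steep-4^ t) (c ∸ 4 * 4 ^ t))
... | α , count≡ , last , h = suc t , α , <⇒≤ c<4^ , trans count≡ (m+[n∸m]≡n 4^≤c) , last , h

lower-bound : ∀ n m .{{_ : NonZero (4 ^ n)}} → 4 ^ n * 10 ^ m ≤ 43 ^ m → ∀ c → 4 ≤ c →
  ∃[ ℓ ] ∃[ α ] (ℓ ≥ 1 × InW ℓ c α × LastIsTwo α ×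
    (+ 1 / (4 ^ n)) ℚ.* ((+ c / 1) ^ℚ n) ℚ.≤ δα α ^ℚ m)
lower-bound n m 4^n≤ c 4≤c with steep-sequence c 4≤c
... | s , α , c≤ , count≡ , last , h = count one α + 1 , α , m≤n+m 1 _ , (refl , count≡) , last ,
  power-lower (43 ^ s) (10 ^ s) c (4 ^ n) m n {{m^n≢0 10 s}} h
    (growth-lower {43} {4} {10} {c} m n s 4^n≤ c≤)

-- With 2^t ≤ c < 2^(t+1), `Bounded-^` at t + 1 covers the whole word, and 2^(t+1) ≤ 2 c.
upper-bound : ∀ n m → 3 ^ m ≤ 2 ^ n → ∀ c → 2 ≤ c → ∀ α → count two α + 1 ≡ c →
  δα α ^ℚ m ℚ.≤ (+ (2 ^ (m + n)) / 1) ℚ.* ((+ c / 1) ^ℚ n)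
upper-bound n m 3^m≤ c 2≤c α count≡ with log-bracket 2 ≤-refl c (≤-trans (s≤s z≤n) 2≤c)
... | t , 2^t≤c , c<2^ = power-upper (2 * 3 ^ suc t) c (2 ^ (m + n)) m n (δα-nonNeg α)
  (δα-bounded {3 ^ suc t} {2 ^ suc t} α (Bounded-^ (suc t)) (subst (_< 2 ^ suc t) (sym count≡) c<2^))
  (growth-upper {3} {2} {c} m n (suc t) 3^m≤ (*-monoʳ-≤ 2 2^t≤c))

-- That is, the logarithm of 4.3 to base 4 is at least 21/20 = 1.05.
4^21·10^20≤43^20 : 4 ^ 21 * 10 ^ 20 ≤ 43 ^ 20
4^21·10^20≤43^20 = ≤ᵇ⇒≤ (4 ^ 21 * 10 ^ 20) (43 ^ 20) tt

-- That is, the logarithm of 3 to base 2 is at most 1.59.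
3^100≤2^159 : 3 ^ 100 ≤ 2 ^ 159
3^100≤2^159 = ≤ᵇ⇒≤ (3 ^ 100) (2 ^ 159) tt

theorem7 : (Σ ℚ λ K → Σ ℕ λ N → (0ℚ ℚ.< K) ×
    ((c : ℕ) → c ≥ 2 → c ≥ N →
    ∃[ ℓ ] ∃[ α ] ((ℓ ≥ 1) × InW ℓ c α × LastIsTwo α ×
    (K ℚ.* ((+ c / 1) ^ℚ 21) ℚ.≤ (δα α ^ℚ 20)))))
    ×
    (Σ ℚ λ K → Σ ℕ λ N →
    ((c : ℕ) → c ≥ 2 → c ≥ N → (ℓ : ℕ) → ℓ ≥ 1 → (α : List Sym) →
    InW ℓ c α → LastIsTwo α →
    (δα α ^ℚ 100) ℚ.≤ K ℚ.* ((+ c / 1) ^ℚ 159)))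
theorem7 =
  -- The supremum is bounded below by one witness α for each c, and above by treating all α
  -- uniformly.
  (+ 1 / (4 ^ 21) , 4 , ℚ.positive⁻¹ (+ 1 / (4 ^ 21)) {{ℚ.normalize-pos 1 (4 ^ 21)}} ,
    λ c _ → lower-bound 21 20 4^21·10^20≤43^20 c) ,
  (+ (2 ^ (100 + 159)) / 1 , 2 ,
    λ c c≥2 _ _ _ α inW _ → upper-bound 159 100 3^100≤2^159 c c≥2 α (proj₂ inW))
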